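{- Let $\alpha:A^{\Delta}\to(H,V)$ be a homomorphism onto a finite forest algebra with $H$ idempotent and commutative, and let $\Gamma\subseteq H$ be a reachability class. Define subsets $B_0,B_1,\ldots$ of $\Gamma\times\Gamma$ by: $B_0=\{(h,h')\in\Gamma\times\Gamma:h\neq h'\}$, and for $j\ge 0$, $B_{j+1}$ is the smallest set that contains $\{(\alpha(a)h,\alpha(a)h'):a\in A,\ (h,h')\in B_j,\ (\alpha(a)h,\alpha(a)h')\in B_0\}$ and is closed under the rules: (i) if $(h,h')\in B_{j+1}$, $g\in H$ and $(h+g,h'+g)\in B_0$ then $(h+g,h'+g)\in B_{j+1}$; (ii) if $(h,h'),(g,g')\in B_{j+1}$ and $(h+g,h'+g')\in B_0$ then $(h+g,h'+g')\in B_{j+1}$. Then for all $h,h'\in\Gamma$ with $h\ne h'$ and all $k\ge0$: $(h,h')\in B_k$ if and only if there exist forests $s,t\in H_A$ with $(s)^{\alpha_\Gamma}\sim_k(t)^{\alpha_\Gamma}$, $\alpha(s)=h$ and $\alpha(t)=h'$. Moreover $B_{k+1}\subseteq B_k$ for all $k\ge0$.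
   Context: $A^{\Delta}=(H_A,V_A)$: free forest algebra over finite alphabet $A$; $H_A$ forests (finite ordered sequences of finite ordered $A$-labelled trees) under concatenation; $V_A$ contexts (forests with one hole) acting by substitution; $as$ is the tree with root $a$ and child forest $s$. A forest algebra $(H,V)$ is an additive monoid $H$ with a monoid $V$ acting faithfully on the left, containing the maps $g\mapsto g+h$, $g\mapsto h+g$. For $a\in A$, $\alpha(a)$ is the image of the context $a\square$. Reachability: $h\le h'$ iff $h=vh'$ for some $v\in V$; a reachability class is a class of the relation ($h\le h'$ and $h'\le h$); $h>\Gamma$ means the class of $h$ is strictly above $\Gamma$. $\alpha_\Gamma:A^{\Delta}\to(H_\Gamma,V_\Gamma)$ is the quotient homomorphism identifying all elements of $\{h:h\not>\Gamma\}$ to a single absorbing element $\infty$ (forests identified iff equal values outside this set or both values in it). For a forest $s$, $s^{\alpha_\Gamma}$ is the forest over $A\times H_\Gamma$ obtained by relabeling each node whose subtree is $at$ with $(a,\alpha_\Gamma(t))$. For an alphabet $B$, $\sim_0$ identifies all forests over $B$, and for $s=b_1s_1+\cdots+b_rs_r$, $s\sim_{k+1}s'$ iff $\{(b_i,[s_i]_{\sim_k}):1\le i\le r\}$ equals the corresponding set for $s'$. -}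

module Defs where

open import Algebra.Bundles using (Monoid)
open import Algebra.Morphism.Structures using (module MonoidMorphisms)
open import Algebra.Morphism.Construct.Composition using (isMonoidHomomorphism)
open import Data.Fin.Base using (Fin)
open import Data.List.Base using (List; []; _∷_; _++_; map)
open import Data.List.Properties using (++-assoc; ++-identityʳ; ++-monoid; ∷-injective)
import Data.List.Relation.Binary.Subset.Setoid as Subset
open import Data.Nat.Base using (ℕ; zero; suc; _≤_; _<_; s≤s)
import Data.Nat.Base as ℕ
import Data.Nat.Properties as ℕ
open import Data.Product.Base using (∃; _×_; _,_; proj₁; proj₂)
open import Data.Product.Relation.Binary.Pointwise.NonDependent using (_×ₛ_)
open import Data.Sum.Base using (_⊎_; inj₁; inj₂)
open import Data.Unit.Base using (⊤; tt)
open import Function.Base using (_∘_)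
open import Function.Bundles using (Inverse; _⇔_)
open import Function.Definitions using (Surjective)
open import Level using (0ℓ)
open import Relation.Binary.Bundles using (Setoid)
open import Relation.Binary.Core using (Rel)
open import Relation.Binary.PropositionalEquality using (_≡_; refl; sym; trans; cong; cong₂; isEquivalence; setoid)
open import Relation.Binary.Structures using (IsEquivalence)
open import Relation.Nullary.Negation using (¬_; contradiction)
open import Relation.Unary using (Pred; _∈_)

Finite : Setoid 0ℓ 0ℓ → Set
Finite S = ∃ λ n → Inverse S (setoid (Fin n))

-- Equality in H and V is a setoid equality, so that quotients of forest
-- algebras are again forest algebras.
record ForestAlgebra : Set₁ where
  infixr 7 _·_
  field
    horizontal : Monoid 0ℓ 0ℓ
    vertical   : Monoid 0ℓ 0ℓ

  module Hor = Monoid horizontal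
  module Ver = Monoid vertical

  open Hor public using (_≈_)
    renaming (Carrier to H; _∙_ to _+_; ε to 0#)
  open Ver public using (_∙_)
    renaming (Carrier to V; _≈_ to _≈ᵥ_; ε to □)

  field
    _·_       : V → H → H
    ·-cong    : ∀ {v w g h} → v ≈ᵥ w → g ≈ h → v · g ≈ w · h
    □-act     : ∀ h → □ · h ≈ h
    ∙-act     : ∀ v w h → (v ∙ w) · h ≈ v · (w · h)
    faithful  : ∀ {v w} → (∀ h → v · h ≈ w · h) → v ≈ᵥ w
    insertʳ   : ∀ h → ∃ λ v → ∀ g → v · g ≈ g + h
    insertˡ   : ∀ h → ∃ λ v → ∀ g → v · g ≈ h + g

record IsFinite (F : ForestAlgebra) : Set where
  open ForestAlgebra F
  field
    H-finite : Finite Hor.setoid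
    V-finite : Finite Ver.setoid

record Homomorphism (F G : ForestAlgebra) : Set where
  private
    module F = ForestAlgebra F
    module G = ForestAlgebra G
  field
    ⟦_⟧ₕ : F.H → G.H
    ⟦_⟧ᵥ : F.V → G.V
    isHorizontalHomomorphism :
      MonoidMorphisms.IsMonoidHomomorphism F.Hor.rawMonoid G.Hor.rawMonoid ⟦_⟧ₕ
    isVerticalHomomorphism :
      MonoidMorphisms.IsMonoidHomomorphism F.Ver.rawMonoid G.Ver.rawMonoid ⟦_⟧ᵥ
    ·-homo : ∀ v h → ⟦ v F.· h ⟧ₕ G.≈ ⟦ v ⟧ᵥ G.· ⟦ h ⟧ₕ

record IsOnto {F G : ForestAlgebra} (α : Homomorphism F G) : Set where
  private
    module F = ForestAlgebra F
    module G = ForestAlgebra G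
  open Homomorphism α
  field
    H-onto : Surjective F._≈_ G._≈_ ⟦_⟧ₕ
    V-onto : Surjective F._≈ᵥ_ G._≈ᵥ_ ⟦_⟧ᵥ

compose : ∀ {F G K} → Homomorphism G K → Homomorphism F G → Homomorphism F K
compose {K = K} β α = record
  { ⟦_⟧ₕ = β.⟦_⟧ₕ ∘ α.⟦_⟧ₕ
  ; ⟦_⟧ᵥ = β.⟦_⟧ᵥ ∘ α.⟦_⟧ᵥ
  ; isHorizontalHomomorphism = isMonoidHomomorphism K.Hor.trans
      α.isHorizontalHomomorphism β.isHorizontalHomomorphism
  ; isVerticalHomomorphism = isMonoidHomomorphism K.Ver.trans
      α.isVerticalHomomorphism β.isVerticalHomomorphism
  ; ·-homo = λ v h → K.Hor.trans
      (MonoidMorphisms.IsMonoidHomomorphism.⟦⟧-cong β.isHorizontalHomomorphism (α.·-homo v h))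
      (β.·-homo _ _)
  }
  where
  module K = ForestAlgebra K
  module α = Homomorphism α
  module β = Homomorphism β

data Tree (A : Set) : Set where
  node : A → List (Tree A) → Tree A

Forest : Set → Set
Forest A = List (Tree A)

-- hole l r is l + □ + r, and node l a c r is l + a c + r.
data Context (A : Set) : Set where
  hole : Forest A → Forest A → Context A
  node : Forest A → A → Context A → Forest A → Context A

module _ {A : Set} where

  _[_] : Context A → Forest A → Forest A
  hole l r     [ s ] = l ++ s ++ r
  node l a c r [ s ] = l ++ node a (c [ s ]) ∷ r

  -- surround l c r is l + c + r.
  surround : Forest A → Context A → Forest A → Context A
  surround l (hole l′ r′)     r = hole (l ++ l′) (r′ ++ r)
  surround l (node l′ a c r′) r = node (l ++ l′) a c (r′ ++ r)

  infixr 9 _∘c_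
  _∘c_ : Context A → Context A → Context A
  hole l r     ∘c d = surround l d r
  node l a c r ∘c d = node l a (c ∘c d) r

  private
    surround-act : ∀ l c r s → surround l c r [ s ] ≡ l ++ c [ s ] ++ r
    surround-act l (hole l′ r′) r s
      rewrite ++-assoc l l′ (s ++ r′ ++ r) | ++-assoc l′ (s ++ r′) r | ++-assoc s r′ r = refl
    surround-act l (node l′ a c r′) r s
      rewrite ++-assoc l l′ (node a (c [ s ]) ∷ r′ ++ r)
            | ++-assoc l′ (node a (c [ s ]) ∷ r′) r = refl

  ∘c-act : ∀ c d s → (c ∘c d) [ s ] ≡ c [ d [ s ] ]
  ∘c-act (hole l r)     d s = surround-act l d r s
  ∘c-act (node l a c r) d s = cong (λ t → l ++ node a t ∷ r) (∘c-act c d s)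

  private
    surround-surround : ∀ l l′ c r′ r →
      surround l (surround l′ c r′) r ≡ surround (l ++ l′) c (r′ ++ r)
    surround-surround l l′ (hole l″ r″) r′ r =
      cong₂ hole (sym (++-assoc l l′ l″)) (++-assoc r″ r′ r)
    surround-surround l l′ (node l″ a c r″) r′ r =
      cong₂ (λ x y → node x a c y) (sym (++-assoc l l′ l″)) (++-assoc r″ r′ r)

    surround-∘c : ∀ l c r d → surround l c r ∘c d ≡ surround l (c ∘c d) r
    surround-∘c l (hole l′ r′)     r d = sym (surround-surround l l′ d r′ r)
    surround-∘c l (node l′ a c r′) r d = refl

    ∘c-assoc : ∀ c d e → (c ∘c d) ∘c e ≡ c ∘c (d ∘c e)
    ∘c-assoc (hole l r)     d e = surround-∘c l d r e
    ∘c-assoc (node l a c r) d e = cong (λ x → node l a x r) (∘c-assoc c d e)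

    ∘c-identityˡ : ∀ c → hole [] [] ∘c c ≡ c
    ∘c-identityˡ (hole l r)     = cong (hole l) (++-identityʳ r)
    ∘c-identityˡ (node l a c r) = cong (node l a c) (++-identityʳ r)

    ∘c-identityʳ : ∀ c → c ∘c hole [] [] ≡ c
    ∘c-identityʳ (hole l r)     = cong (λ x → hole x r) (++-identityʳ l)
    ∘c-identityʳ (node l a c r) = cong (λ x → node l a x r) (∘c-identityʳ c)

    -- Faithfulness: plug in a tree larger than both contexts.

    treeSize : Tree A → ℕ
    size     : Forest A → ℕ
    treeSize (node a s) = suc (size s)
    size []      = 0
    size (t ∷ s) = treeSize t ℕ.+ size s

    size-++ : ∀ s t → size (s ++ t) ≡ size s ℕ.+ size t
    size-++ []      t = refl
    size-++ (x ∷ s) t =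
      trans (cong (treeSize x ℕ.+_) (size-++ s t)) (sym (ℕ.+-assoc (treeSize x) _ _))

    contextSize : Context A → ℕ
    contextSize (hole l r)     = size l
    contextSize (node l a c r) = size l ℕ.+ contextSize c

    ≤-middle : ∀ l m r → size m ≤ size (l ++ m ++ r)
    ≤-middle l m r rewrite size-++ l (m ++ r) | size-++ m r =
      ℕ.≤-trans (ℕ.m≤m+n _ _) (ℕ.m≤n+m _ (size l))

    ≤-plug : ∀ c s → size s ≤ size (c [ s ])
    ≤-plug (hole l r)     s = ≤-middle l s r
    ≤-plug (node l a c r) s = ℕ.≤-trans (≤-plug c s)
      (ℕ.≤-trans (ℕ.n≤1+n _)
        (ℕ.≤-trans (ℕ.m≤m+n _ 0) (≤-middle l (node a (c [ s ]) ∷ []) r)))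

    path : A → ℕ → Tree A
    path a zero    = node a []
    path a (suc n) = node a (path a n ∷ [])

    path-size : ∀ a n → n < treeSize (path a n)
    path-size a zero    = s≤s ℕ.z≤n
    path-size a (suc n) = s≤s (ℕ.≤-trans (path-size a n) (ℕ.m≤m+n _ 0))

    split : ∀ N l l′ {x y r r′} → size l < N → size l′ < N → N ≤ treeSize x → N ≤ treeSize y →
            l ++ x ∷ r ≡ l′ ++ y ∷ r′ → l ≡ l′ × x ≡ y × r ≡ r′
    split N []      []       p q u v eq with refl , refl ← ∷-injective eq = refl , refl , refl
    split N []      (z ∷ l′) p q u v eq with refl ← proj₁ (∷-injective eq) =
      contradiction u (ℕ.<⇒≱ (ℕ.≤-<-trans (ℕ.m≤m+n _ (size l′)) q))
    split N (z ∷ l) []       p q u v eq with refl ← proj₁ (∷-injective eq) =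
      contradiction v (ℕ.<⇒≱ (ℕ.≤-<-trans (ℕ.m≤m+n _ (size l)) p))
    split N (z ∷ l) (w ∷ l′) p q u v eq with refl , eq′ ← ∷-injective eq
      with refl , x≡y , r≡r′ ← split N l l′ (ℕ.≤-<-trans (ℕ.m≤n+m _ (treeSize z)) p)
                                 (ℕ.≤-<-trans (ℕ.m≤n+m _ (treeSize z)) q) u v eq′ =
      refl , x≡y , r≡r′

    node-injective : ∀ {a b : A} {s t} → Tree.node a s ≡ node b t → a ≡ b × s ≡ t
    node-injective refl = refl , refl

    big : ∀ c p → treeSize p ≤ size (c [ p ∷ [] ])
    big c p = ℕ.≤-trans (ℕ.m≤m+n _ 0) (≤-plug c (p ∷ []))

    plug-injective : ∀ p c d → contextSize c < treeSize p → contextSize d < treeSize p →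
                     c [ p ∷ [] ] ≡ d [ p ∷ [] ] → c ≡ d
    plug-injective p (hole l r) (hole l′ r′) u v eq
      with refl , _ , refl ← split (treeSize p) l l′ u v ℕ.≤-refl ℕ.≤-refl eq = refl
    plug-injective p (hole l r) (node l′ a d r′) u v eq
      with _ , e , _ ← split (treeSize p) l l′ u (ℕ.≤-<-trans (ℕ.m≤m+n _ _) v)
                         ℕ.≤-refl (ℕ.m≤n⇒m≤1+n (big d p)) eq =
      contradiction (ℕ.≤-reflexive (cong treeSize (sym e))) (ℕ.<⇒≱ (s≤s (big d p)))
    plug-injective p (node l a c r) (hole l′ r′) u v eq
      with _ , e , _ ← split (treeSize p) l l′ (ℕ.≤-<-trans (ℕ.m≤m+n _ _) u) v
                         (ℕ.m≤n⇒m≤1+n (big c p)) ℕ.≤-refl eq =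
      contradiction (ℕ.≤-reflexive (cong treeSize e)) (ℕ.<⇒≱ (s≤s (big c p)))
    plug-injective p (node l a c r) (node l′ b d r′) u v eq
      with refl , e , refl ← split (treeSize p) l l′ (ℕ.≤-<-trans (ℕ.m≤m+n _ _) u)
             (ℕ.≤-<-trans (ℕ.m≤m+n _ _) v)
             (ℕ.m≤n⇒m≤1+n (big c p)) (ℕ.m≤n⇒m≤1+n (big d p)) eq
      with refl , e′ ← node-injective e =
      cong (λ x → node l a x r)
        (plug-injective p c d (ℕ.≤-<-trans (ℕ.m≤n+m _ (size l)) u)
          (ℕ.≤-<-trans (ℕ.m≤n+m _ (size l)) v) e′)

    faithful′ : A → ∀ c d → (∀ s → c [ s ] ≡ d [ s ]) → c ≡ d
    faithful′ a c d eq = plug-injective (path a N) c d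
      (ℕ.≤-<-trans (ℕ.m≤m+n _ _) (path-size a N))
      (ℕ.≤-<-trans (ℕ.m≤n+m _ (contextSize c)) (path-size a N))
      (eq _)
      where N = contextSize c ℕ.+ contextSize d

  free-faithful : ∀ c d → (∀ s → c [ s ] ≡ d [ s ]) → c ≡ d
  free-faithful (hole [] []) (hole [] []) eq = refl
  free-faithful c@(hole (node a _ ∷ _) _) d eq = faithful′ a c d eq
  free-faithful c@(hole [] (node a _ ∷ _)) d eq = faithful′ a c d eq
  free-faithful c@(node _ a _ _) d eq = faithful′ a c d eq
  free-faithful c d@(hole (node a _ ∷ _) _) eq = faithful′ a c d eq
  free-faithful c d@(hole [] (node a _ ∷ _)) eq = faithful′ a c d eq
  free-faithful c d@(node _ a _ _) eq = faithful′ a c d eq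

  contextMonoid : Monoid 0ℓ 0ℓ
  contextMonoid = record
    { Carrier  = Context A
    ; _≈_      = _≡_
    ; _∙_      = _∘c_
    ; ε        = hole [] []
    ; isMonoid = record
      { isSemigroup = record
        { isMagma = record { isEquivalence = isEquivalence ; ∙-cong = cong₂ _∘c_ }
        ; assoc   = ∘c-assoc
        }
      ; identity = ∘c-identityˡ , ∘c-identityʳ
      }
    }

_^Δ : Set → ForestAlgebra
A ^Δ = record
  { horizontal = ++-monoid (Tree A)
  ; vertical   = contextMonoid {A}
  ; _·_        = _[_]
  ; ·-cong     = cong₂ _[_]
  ; □-act      = ++-identityʳ
  ; ∙-act      = ∘c-act
  ; faithful   = free-faithful _ _
  ; insertʳ    = λ h → hole [] h , λ g → refl
  ; insertˡ    = λ h → hole h [] , λ g → cong (h ++_) (++-identityʳ g)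
  }

letter : ∀ {A} → A → Context A
letter a = node [] a (hole [] []) []

module Reachability (F : ForestAlgebra) where
  open ForestAlgebra F

  infix 4 _≼_ _≻_

  _≼_ : Rel H 0ℓ
  h ≼ h′ = ∃ λ v → h ≈ v · h′

  IsReachabilityClass : Pred H 0ℓ → Set
  IsReachabilityClass Γ = ∃ λ γ → ∀ h → h ∈ Γ ⇔ (h ≼ γ × γ ≼ h)

  _≻_ : H → Pred H 0ℓ → Set
  h ≻ Γ = ∀ γ → γ ∈ Γ → γ ≼ h × ¬ h ≼ γ

  module _ (Γ : Pred H 0ℓ) where

    -- Equality in H_Γ; the common class of all h with ¬ h ≻ Γ is ∞.
    _≈Γ_ : Rel H 0ℓ
    h ≈Γ h′ = h ≈ h′ ⊎ (¬ h ≻ Γ × ¬ h′ ≻ Γ)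

    -- V_Γ is the quotient of V that acts faithfully on H_Γ.
    _≈ᵥΓ_ : Rel V 0ℓ
    v ≈ᵥΓ w = ∀ h → (v · h) ≈Γ (w · h)

    ≼-trans : ∀ {x y z} → x ≼ y → y ≼ z → x ≼ z
    ≼-trans (v , p) (w , q) =
      v ∙ w , Hor.trans p (Hor.trans (·-cong Ver.refl q) (Hor.sym (∙-act v w _)))

    ≻-up : ∀ {g h} → g ≼ h → g ≻ Γ → h ≻ Γ
    ≻-up g≼h g≻ γ γ∈ = ≼-trans (proj₁ (g≻ γ γ∈)) g≼h , λ h≼γ → proj₂ (g≻ γ γ∈) (≼-trans g≼h h≼γ)

    ≈⇒≼ : ∀ {g h} → g ≈ h → g ≼ h
    ≈⇒≼ g≈h = □ , Hor.trans g≈h (Hor.sym (□-act _))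

    ≈Γ-equivalence : IsEquivalence _≈Γ_
    ≈Γ-equivalence = record
      { refl  = inj₁ Hor.refl
      ; sym   = λ { (inj₁ p) → inj₁ (Hor.sym p) ; (inj₂ (p , q)) → inj₂ (q , p) }
      ; trans = λ where
          (inj₁ p)       (inj₁ q)       → inj₁ (Hor.trans p q)
          (inj₁ p)       (inj₂ (q , r)) → inj₂ (q ∘ ≻-up (≈⇒≼ p) , r)
          (inj₂ (p , q)) (inj₁ r)       → inj₂ (p , q ∘ ≻-up (≈⇒≼ (Hor.sym r)))
          (inj₂ (p , _)) (inj₂ (_ , r)) → inj₂ (p , r)
      }

    module ≈Γ = IsEquivalence ≈Γ-equivalence

    ·-congʳ : ∀ v {g h} → g ≈Γ h → (v · g) ≈Γ (v · h)
    ·-congʳ v (inj₁ p)       = inj₁ (·-cong Ver.refl p)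
    ·-congʳ v (inj₂ (p , q)) =
      inj₂ (p ∘ ≻-up (v , Hor.refl) , q ∘ ≻-up (v , Hor.refl))

    +-congˡ : ∀ g {h h′} → h ≈Γ h′ → (g + h) ≈Γ (g + h′)
    +-congˡ g p with v , eq ← insertˡ g =
      ≈Γ.trans (inj₁ (Hor.sym (eq _))) (≈Γ.trans (·-congʳ v p) (inj₁ (eq _)))

    +-congʳ : ∀ g {h h′} → h ≈Γ h′ → (h + g) ≈Γ (h′ + g)
    +-congʳ g p with v , eq ← insertʳ g =
      ≈Γ.trans (inj₁ (Hor.sym (eq _))) (≈Γ.trans (·-congʳ v p) (inj₁ (eq _)))

    ≈ᵥ⇒≈ᵥΓ : ∀ {v w} → v ≈ᵥ w → v ≈ᵥΓ w
    ≈ᵥ⇒≈ᵥΓ p h = inj₁ (·-cong p Hor.refl)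

    ∙-congΓ : ∀ {v v′ w w′} → v ≈ᵥΓ v′ → w ≈ᵥΓ w′ → (v ∙ w) ≈ᵥΓ (v′ ∙ w′)
    ∙-congΓ {v} p q h = ≈Γ.trans (inj₁ (∙-act _ _ h))
      (≈Γ.trans (·-congʳ v (q h)) (≈Γ.trans (p _) (inj₁ (Hor.sym (∙-act _ _ h)))))

    quotient : ForestAlgebra
    quotient = record
      { horizontal = record
        { Carrier  = H
        ; _≈_      = _≈Γ_
        ; _∙_      = _+_
        ; ε        = 0#
        ; isMonoid = record
          { isSemigroup = record
            { isMagma = record
              { isEquivalence = ≈Γ-equivalence
              ; ∙-cong        = λ {x} {y} {u} p q → ≈Γ.trans (+-congʳ u p) (+-congˡ y q)
              }
            ; assoc = λ x y z → inj₁ (Hor.assoc x y z)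
            }
          ; identity = (λ x → inj₁ (Hor.identityˡ x)) , (λ x → inj₁ (Hor.identityʳ x))
          }
        }
      ; vertical = record
        { Carrier  = V
        ; _≈_      = _≈ᵥΓ_
        ; _∙_      = _∙_
        ; ε        = □
        ; isMonoid = record
          { isSemigroup = record
            { isMagma = record
              { isEquivalence = record
                { refl  = λ h → ≈Γ.refl
                ; sym   = λ p h → ≈Γ.sym (p h)
                ; trans = λ p q h → ≈Γ.trans (p h) (q h)
                }
              ; ∙-cong = λ {v} {v′} {w} {w′} → ∙-congΓ {v} {v′} {w} {w′}
              }
            ; assoc = λ u v w → ≈ᵥ⇒≈ᵥΓ (Ver.assoc u v w)
            }
          ; identity = (λ v → ≈ᵥ⇒≈ᵥΓ (Ver.identityˡ v)) , (λ v → ≈ᵥ⇒≈ᵥΓ (Ver.identityʳ v))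
          }
        }
      ; _·_      = _·_
      ; ·-cong   = λ {v} p q → ≈Γ.trans (·-congʳ v q) (p _)
      ; □-act    = λ h → inj₁ (□-act h)
      ; ∙-act    = λ v w h → inj₁ (∙-act v w h)
      ; faithful = λ p → p
      ; insertʳ  = λ h → proj₁ (insertʳ h) , λ g → inj₁ (proj₂ (insertʳ h) g)
      ; insertˡ  = λ h → proj₁ (insertˡ h) , λ g → inj₁ (proj₂ (insertˡ h) g)
      }

    projection : Homomorphism F quotient
    projection = record
      { ⟦_⟧ₕ = λ h → h
      ; ⟦_⟧ᵥ = λ v → v
      ; isHorizontalHomomorphism = record
        { isMagmaHomomorphism = record
          { isRelHomomorphism = record { cong = inj₁ }
          ; homo              = λ _ _ → ≈Γ.refl
          }
        ; ε-homo = ≈Γ.refl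
        }
      ; isVerticalHomomorphism = record
        { isMagmaHomomorphism = record
          { isRelHomomorphism = record { cong = ≈ᵥ⇒≈ᵥΓ }
          ; homo              = λ _ _ _ → ≈Γ.refl
          }
        ; ε-homo = λ _ → ≈Γ.refl
        }
      ; ·-homo = λ _ _ → ≈Γ.refl
      }

module _ {A : Set} {G : ForestAlgebra} (β : Homomorphism (A ^Δ) G) where
  open ForestAlgebra G using (H; module Hor)
  open Homomorphism β

  labels : Setoid 0ℓ 0ℓ
  labels = setoid A ×ₛ Hor.setoid

  relabel     : Forest A → Forest (A × H)
  relabelTree : Tree A → Tree (A × H)
  relabel []      = []
  relabel (t ∷ s) = relabelTree t ∷ relabel s
  relabelTree (node a t) = node (a , ⟦ t ⟧ₕ) (relabel t)

module Similarity (B : Setoid 0ℓ 0ℓ) where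
  open Setoid B using () renaming (Carrier to Label)

  roots : Forest Label → List (Label × Forest Label)
  roots = map λ { (node b s) → b , s }

  Sim : ℕ → Rel (Forest Label) 0ℓ
  Sim-isEquivalence : ∀ k → IsEquivalence (Sim k)

  Sim-setoid : ℕ → Setoid 0ℓ 0ℓ
  Sim-setoid k = record { isEquivalence = Sim-isEquivalence k }

  -- Membership in a list over B ×ₛ Sim-setoid k is up to equality of letters
  -- and ∼ₖ, so mutual inclusion is equality of the sets of pairs (b , [s]_∼ₖ).
  Sim zero    s s′ = ⊤
  Sim (suc k) s s′ = roots s ⊆ roots s′ × roots s′ ⊆ roots s
    where open Subset (B ×ₛ Sim-setoid k) using (_⊆_)

  Sim-isEquivalence zero    = record { refl = tt ; sym = λ _ → tt ; trans = λ _ _ → tt }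
  Sim-isEquivalence (suc k) = record
    { refl  = (λ x → x) , (λ x → x)
    ; sym   = λ (p , q) → q , p
    ; trans = λ (p , q) (p′ , q′) → (λ x → p′ (p x)) , (λ x → q (q′ x))
    }

infix 4 _⊢_∼[_]_
_⊢_∼[_]_ : (B : Setoid 0ℓ 0ℓ) → Forest (Setoid.Carrier B) → ℕ → Forest (Setoid.Carrier B) → Set
B ⊢ s ∼[ k ] s′ = Similarity.Sim B k s s′

module Confusion {A : Set} {F : ForestAlgebra} (α : Homomorphism (A ^Δ) F)
                 (Γ : Pred (ForestAlgebra.H F) 0ℓ) where
  open ForestAlgebra F
  open Reachability F
  open Homomorphism α

  αΓ : Homomorphism (A ^Δ) (quotient Γ)
  αΓ = compose (projection Γ) α

  B₀ : Rel H 0ℓ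
  B₀ h h′ = h ∈ Γ × h′ ∈ Γ × ¬ h ≈ h′

  -- The rules are stated up to _≈_, which makes this a set of pairs in H
  -- modulo _≈_.
  data Closure (R : Rel H 0ℓ) : Rel H 0ℓ where
    base  : ∀ {x y h h′} (a : A) → R h h′ →
            x ≈ ⟦ letter a ⟧ᵥ · h → y ≈ ⟦ letter a ⟧ᵥ · h′ → B₀ x y → Closure R x y
    ruleⁱ : ∀ {x y h h′} (g : H) → Closure R h h′ →
            x ≈ h + g → y ≈ h′ + g → B₀ x y → Closure R x y
    ruleⁱⁱ : ∀ {x y h h′ g g′} → Closure R h h′ → Closure R g g′ →
            x ≈ h + g → y ≈ h′ + g′ → B₀ x y → Closure R x y

  B : ℕ → Rel H 0ℓ
  B zero    = B₀
  B (suc j) = Closure (B j)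

{-# OPTIONS --safe #-}
-- If the relabelled forests s and t are ∼ₖ₊₁-equivalent, idempotence and
-- commutativity let their values be written as sums over the same finite set
-- of matched pairs of root trees a u, a w.  The u and w of a pair have the same
-- value in H_Γ: either they are equal in H, and contribute equal summands, or
-- both values lie in Γ and, when distinct, are in Bₖ by induction.  All partial
-- sums stay above Γ, so adding up the pairs only uses the rules for Bₖ₊₁.
-- Conversely a derivation in Bₖ₊₁ is copied by building forests, because any two
-- elements of Γ get the same label ∞.
module Submission where

open import Defs hiding (_[_])
open import Algebra.Bundles using (CommutativeSemigroup)
open import Algebra.Definitions using (Commutative; Idempotent)
open import Algebra.Morphism.Structures using (module MonoidMorphisms)
import Algebra.Properties.CommutativeSemigroup as CommutativeSemigroupProperties
open import Data.Fin.Properties using (any?; _≟_)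
open import Data.List.Base using ([]; _∷_; _++_; [_])
open import Data.List.Properties using (++-identityʳ; map-++)
import Data.List.Membership.Setoid as Membership
import Data.List.Relation.Binary.Subset.Setoid.Properties as Subset
open import Data.List.Relation.Unary.Any using (here; there)
open import Data.Nat.Base using (ℕ; zero; suc)
open import Data.Product.Base using (∃; ∃₂; _×_; _,_; proj₁; proj₂)
open import Data.Product.Relation.Binary.Pointwise.NonDependent using (_×ₛ_)
open import Data.Sum.Base using (_⊎_; inj₁; inj₂)
open import Data.Unit.Base using (tt)
open import Function.Base using (flip)
open import Function.Bundles using (_⇔_; mk⇔; Equivalence; Inverse)
open import Function.Properties.Inverse using (Inverse⇒Injection)
open import Level using (0ℓ)
open import Relation.Binary.Core using (Rel)
open import Relation.Binary.Bundles using (Setoid)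
open import Relation.Binary.Definitions using (Decidable)
open import Relation.Binary.PropositionalEquality using (_≡_; refl; sym; trans; cong; setoid)
import Relation.Binary.Reasoning.Setoid as SetoidReasoning
open import Relation.Nullary.Decidable using (yes; no; map′; via-injection)
open import Relation.Nullary.Negation using (¬_; contradiction)
open import Relation.Unary using (Pred; _∈_)
open ForestAlgebra using (H; _≈_; _+_)
open Reachability using (IsReachabilityClass)
open Homomorphism using (⟦_⟧ₕ)
open Confusion using (αΓ; B)

-- Decidability from finiteness

Finite⇒≈? : ∀ {S} → Finite S → Decidable (Setoid._≈_ S)
Finite⇒≈? (_ , inverse) = via-injection (Inverse⇒Injection inverse) _≟_

module FiniteReachability (F : ForestAlgebra) (F-finite : IsFinite F) where
  open ForestAlgebra F hiding (H; _≈_; _+_)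
  open Reachability F using (_≼_)
  open IsFinite F-finite

  infix 4 _≈?_ _≼?_

  _≈?_ : Decidable (_≈_ F)
  _≈?_ = Finite⇒≈? H-finite

  -- An enumeration of `V` turns the search for a context into a search over a `Fin`.
  _≼?_ : Decidable _≼_
  h ≼? h′ = map′ (λ (i , p) → from i , p)
    (λ (v , p) → to v , Hor.trans p (·-cong (Ver.sym (strictlyInverseʳ v)) Hor.refl))
    (any? λ i → h ≈? from i · h′)
    where open Inverse (proj₂ V-finite)

-- Similarity of relabelled forests

module RelabelProperties {A : Set} {G : ForestAlgebra} (β : Homomorphism (A ^Δ) G) where
  open Similarity (labels β)

  relabel-++ : ∀ s t → relabel β (s ++ t) ≡ relabel β s ++ relabel β t
  relabel-++ []      t = refl
  relabel-++ (x ∷ s) t = cong (relabelTree β x ∷_) (relabel-++ s t)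

  roots-relabel-++ : ∀ s t → roots (relabel β (s ++ t)) ≡ roots (relabel β s) ++ roots (relabel β t)
  roots-relabel-++ s t = trans (cong roots (relabel-++ s t)) (map-++ _ (relabel β s) _)

  -- The root set of a concatenation is the union of the two root sets.
  Sim-++ : ∀ k s s′ t t′ →
           Sim k (relabel β s) (relabel β s′) → Sim k (relabel β t) (relabel β t′) →
           Sim k (relabel β (s ++ t)) (relabel β (s′ ++ t′))
  Sim-++ zero    s s′ t t′ _ _ = tt
  Sim-++ (suc k) s s′ t t′ (p , p′) (q , q′)
    rewrite roots-relabel-++ s t | roots-relabel-++ s′ t′ = Subset.++⁺ S p q , Subset.++⁺ S p′ q′
    where S = labels β ×ₛ Sim-setoid k

  -- Each side has a single root, and its label records the value below it only up to equality in
  -- `G`; for the quotient this lets distinct elements of Γ pass.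
  Sim-node : ∀ k a {s t} → ForestAlgebra._≈_ G (⟦ β ⟧ₕ s) (⟦ β ⟧ₕ t) →
             Sim k (relabel β s) (relabel β t) →
             Sim (suc k) (relabel β [ node a s ]) (relabel β [ node a t ])
  Sim-node k a s≈t s∼t =
      (λ { (here p) → here (S.trans p ((refl , s≈t) , s∼t)) })
    , (λ { (here p) → here (S.trans p (S.sym ((refl , s≈t) , s∼t))) })
    where module S = Setoid (labels β ×ₛ Sim-setoid k)

module Proof {A : Set} (F : ForestAlgebra) (F-finite : IsFinite F)
             (+-idem : Idempotent (_≈_ F) (_+_ F)) (+-comm : Commutative (_≈_ F) (_+_ F))
             (α : Homomorphism (A ^Δ) F) (onto : IsOnto α)
             (Γ : Pred (H F) 0ℓ) (isClass : IsReachabilityClass F Γ) where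

  open ForestAlgebra F renaming (H to |H|; _≈_ to infix 4 _≈ᴴ_; _+_ to infixl 6 _⊕_)
  open Hor using (∙-cong; ∙-congˡ; ∙-congʳ; identityˡ; assoc)
    renaming (refl to ≈-refl; sym to ≈-sym; trans to ≈-trans)
  open Reachability F using (_≼_; _≻_; ≼-trans; ≈⇒≼)
  open Homomorphism α using (⟦_⟧ᵥ; isHorizontalHomomorphism; ·-homo)
  open MonoidMorphisms.IsMonoidHomomorphism isHorizontalHomomorphism using (homo; ε-homo; ⟦⟧-cong)
  open Confusion α Γ using (B₀; Closure; base; ruleⁱ; ruleⁱⁱ)
  open FiniteReachability F F-finite
  open RelabelProperties (αΓ α Γ)
  open Similarity (labels (αΓ α Γ)) using (Sim; Sim-setoid; roots)

  +-commutativeSemigroup : CommutativeSemigroup 0ℓ 0ℓ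
  +-commutativeSemigroup = record
    { isCommutativeSemigroup = record { isSemigroup = Hor.isSemigroup ; comm = +-comm } }

  open CommutativeSemigroupProperties +-commutativeSemigroup using (x∙yz≈y∙xz)

  -- Values of forests

  value : Forest A → |H|
  value = ⟦ α ⟧ₕ

  apply : A → |H| → |H|
  apply a = ⟦ letter a ⟧ᵥ ·_

  value-node : ∀ a s → value [ node a s ] ≈ᴴ apply a (value s)
  -- Plugging `s` into `letter a` yields `s ++ []` below the root.
  value-node a s = ≈-trans (⟦⟧-cong (cong (λ u → [ node a u ]) (sym (++-identityʳ s))))
                           (·-homo (letter a) s)

  value-∷ : ∀ a s t → value (node a s ∷ t) ≈ᴴ apply a (value s) ⊕ value t
  value-∷ a s t = ≈-trans (homo [ node a s ] t) (∙-congʳ (value-node a s))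

  -- The class Γ in the reachability order

  γ : |H|
  γ = proj₁ isClass

  ∈Γ⇒≼γ : ∀ {h} → h ∈ Γ → h ≼ γ
  ∈Γ⇒≼γ {h} h∈Γ = proj₁ (Equivalence.to (proj₂ isClass h) h∈Γ)

  ∈Γ⇒γ≼ : ∀ {h} → h ∈ Γ → γ ≼ h
  ∈Γ⇒γ≼ {h} h∈Γ = proj₂ (Equivalence.to (proj₂ isClass h) h∈Γ)

  between⇒∈Γ : ∀ {h} → h ≼ γ → γ ≼ h → h ∈ Γ
  between⇒∈Γ {h} p q = Equivalence.from (proj₂ isClass h) (p , q)

  -- Γ is convex: going down from Γ, one leaves it only by losing `γ ≼_`.
  Γ-down : ∀ {g h} → h ∈ Γ → g ≼ h → γ ≼ g → g ∈ Γ
  Γ-down h∈Γ g≼h = between⇒∈Γ (≼-trans Γ g≼h (∈Γ⇒≼γ h∈Γ))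

  ∈Γ⇒¬≻ : ∀ {h} → h ∈ Γ → ¬ h ≻ Γ
  ∈Γ⇒¬≻ {h} h∈Γ h≻Γ = proj₂ (h≻Γ h h∈Γ) (≈⇒≼ Γ ≈-refl)

  -- If `h ≼ γ` failed, `h` would be strictly above every element of the class; deciding `h ≼ γ`
  -- makes this constructive.
  ¬≻⇒∈Γ : ∀ {h} → γ ≼ h → ¬ h ≻ Γ → h ∈ Γ
  ¬≻⇒∈Γ {h} γ≼h h⊁Γ with h ≼? γ
  ... | yes h≼γ = between⇒∈Γ h≼γ γ≼h
  ... | no  h⋠γ = contradiction
    (λ g g∈Γ → ≼-trans Γ (∈Γ⇒≼γ g∈Γ) γ≼h , λ h≼g → h⋠γ (≼-trans Γ h≼g (∈Γ⇒≼γ g∈Γ))) h⊁Γ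

  x⊕y≼x : ∀ x y → x ⊕ y ≼ x
  x⊕y≼x x y = proj₁ (insertʳ y) , ≈-sym (proj₂ (insertʳ y) x)

  x⊕y≼y : ∀ x y → x ⊕ y ≼ y
  x⊕y≼y x y = proj₁ (insertˡ x) , ≈-sym (proj₂ (insertˡ x) y)

  -- The closure rules and the descending chain

  Closure⇒B₀ : ∀ {R x y} → Closure R x y → B₀ x y
  Closure⇒B₀ (base _ _ _ _ b) = b
  Closure⇒B₀ (ruleⁱ _ _ _ _ b) = b
  Closure⇒B₀ (ruleⁱⁱ _ _ _ _ b) = b

  Closure-mono : ∀ {R S} → (∀ {x y} → R x y → S x y) → ∀ {x y} → Closure R x y → Closure S x y
  Closure-mono f (base a r p q b)   = base a (f r) p q b
  Closure-mono f (ruleⁱ g c p q b)  = ruleⁱ g (Closure-mono f c) p q b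
  Closure-mono f (ruleⁱⁱ c d p q b) = ruleⁱⁱ (Closure-mono f c) (Closure-mono f d) p q b

  B-antitone : ∀ k {x y} → B α Γ (suc k) x y → B α Γ k x y
  B-antitone zero    = Closure⇒B₀
  B-antitone (suc k) = Closure-mono (B-antitone k)

  B⇒B₀ : ∀ k {x y} → B α Γ k x y → B₀ x y
  B⇒B₀ zero    b = b
  B⇒B₀ (suc k) c = Closure⇒B₀ c

  -- Only the last rule changes: its equations up to `≈` absorb the new endpoints.
  Closure-resp : ∀ {R x y x′ y′} → x′ ≈ᴴ x → y′ ≈ᴴ y → B₀ x′ y′ → Closure R x y → Closure R x′ y′
  Closure-resp p q b (base a r p′ q′ _)   = base a r (≈-trans p p′) (≈-trans q q′) b
  Closure-resp p q b (ruleⁱ g c p′ q′ _)  = ruleⁱ g c (≈-trans p p′) (≈-trans q q′) b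
  Closure-resp p q b (ruleⁱⁱ c d p′ q′ _) = ruleⁱⁱ c d (≈-trans p p′) (≈-trans q q′) b

  -- From derivations to forests

  Confused : ℕ → Rel |H| 0ℓ
  Confused k h h′ = ∃₂ λ s t →
    Sim k (relabel (αΓ α Γ) s) (relabel (αΓ α Γ) t) × value s ≈ᴴ h × value t ≈ᴴ h′

  preimage : ∀ h → ∃ λ s → value s ≈ᴴ h
  preimage h with s , p ← IsOnto.H-onto onto h = s , p refl

  -- Keeping `R` abstract separates the induction on derivations from the one on `k`.
  Closure⇒Confused : ∀ {R} k → (∀ {h h′} → R h h′ → B₀ h h′) →
                     (∀ {h h′} → R h h′ → Confused k h h′) →
                     ∀ {x y} → Closure R x y → Confused (suc k) x y
  Closure⇒Confused k R⇒B₀ R⇒C (base a r p q _)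
    with s , t , s∼t , s≈ , t≈ ← R⇒C r | h∈Γ , h′∈Γ , _ ← R⇒B₀ r =
      [ node a s ] , [ node a t ]
    -- Both values lie in Γ, so both are ∞ in the quotient and the root labels agree.
    , Sim-node k a {s} {t} (inj₂ (∞ h∈Γ s≈ , ∞ h′∈Γ t≈)) s∼t
    , ≈-trans (value-node a s) (≈-trans (·-cong Ver.refl s≈) (≈-sym p))
    , ≈-trans (value-node a t) (≈-trans (·-cong Ver.refl t≈) (≈-sym q))
    where
    ∞ : ∀ {g h} → h ∈ Γ → g ≈ᴴ h → ¬ g ≻ Γ
    ∞ h∈Γ g≈h = ∈Γ⇒¬≻ (Γ-down h∈Γ (≈⇒≼ Γ g≈h) (≼-trans Γ (∈Γ⇒γ≼ h∈Γ) (≈⇒≼ Γ (≈-sym g≈h))))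
  Closure⇒Confused k R⇒B₀ R⇒C (ruleⁱ g c p q _)
    with s , t , s∼t , s≈ , t≈ ← Closure⇒Confused k R⇒B₀ R⇒C c | u , u≈ ← preimage g =
      s ++ u , t ++ u
    , Sim-++ (suc k) s t u u s∼t (Setoid.refl (Sim-setoid (suc k)) {relabel (αΓ α Γ) u})
    , ≈-trans (homo s u) (≈-trans (∙-cong s≈ u≈) (≈-sym p))
    , ≈-trans (homo t u) (≈-trans (∙-cong t≈ u≈) (≈-sym q))
  Closure⇒Confused k R⇒B₀ R⇒C (ruleⁱⁱ c d p q _)
    with s , t , s∼t , s≈ , t≈ ← Closure⇒Confused k R⇒B₀ R⇒C c
       | u , w , u∼w , u≈ , w≈ ← Closure⇒Confused k R⇒B₀ R⇒C d =
      s ++ u , t ++ w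
    , Sim-++ (suc k) s t u w s∼t u∼w
    , ≈-trans (homo s u) (≈-trans (∙-cong s≈ u≈) (≈-sym p))
    , ≈-trans (homo t w) (≈-trans (∙-cong t≈ w≈) (≈-sym q))

  B⇒Confused : ∀ k {h h′} → B α Γ k h h′ → Confused k h h′
  B⇒Confused zero {h} {h′} _ with s , s≈ ← preimage h | t , t≈ ← preimage h′ =
    s , t , tt , s≈ , t≈
  B⇒Confused (suc k) = Closure⇒Confused k (B⇒B₀ k) (B⇒Confused k)

  -- Sums of linked pairs

  -- Guarding by γ ≼_ makes Linked additive: it restricts attention to pairs that
  -- can still be summands of elements of Γ.
  Linked : Rel |H| 0ℓ → Rel |H| 0ℓ
  Linked R x y = γ ≼ x → γ ≼ y → x ≈ᴴ y ⊎ Closure R x y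

  module _ {R : Rel |H| 0ℓ} where

    ≈-or-Closure : ∀ {x y} → (B₀ x y → Closure R x y) →
                   x ∈ Γ → y ∈ Γ → x ≈ᴴ y ⊎ Closure R x y
    ≈-or-Closure {x} {y} f x∈Γ y∈Γ with x ≈? y
    ... | yes x≈y = inj₁ x≈y
    ... | no  x≉y = inj₂ (f (x∈Γ , y∈Γ , x≉y))

    Linked-0 : Linked R 0# 0#
    Linked-0 _ _ = inj₁ ≈-refl

    Linked-⊕ : ∀ {x y x′ y′} → Linked R x y → Linked R x′ y′ → Linked R (x ⊕ x′) (y ⊕ y′)
    Linked-⊕ {x} {y} {x′} {y′} l l′ p q
      -- A sum is reachable from each summand, so the guards pass to the summands.
      with l (≼-trans Γ p (x⊕y≼x x x′)) (≼-trans Γ q (x⊕y≼x y y′))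
         | l′ (≼-trans Γ p (x⊕y≼y x x′)) (≼-trans Γ q (x⊕y≼y y y′))
    ... | inj₁ e | inj₁ e′ = inj₁ (∙-cong e e′)
    ... | inj₂ c | inj₁ e′ with x∈Γ , y∈Γ , _ ← Closure⇒B₀ c =
      ≈-or-Closure (ruleⁱ x′ c ≈-refl (∙-congˡ (≈-sym e′)))
        (Γ-down x∈Γ (x⊕y≼x x x′) p) (Γ-down y∈Γ (x⊕y≼x y y′) q)
    -- Rule (i) adds on the right only, so the sums are first commuted.
    ... | inj₁ e | inj₂ c′ with x′∈Γ , y′∈Γ , _ ← Closure⇒B₀ c′ =
      ≈-or-Closure (ruleⁱ x c′ (+-comm x x′) (≈-trans (∙-congʳ (≈-sym e)) (+-comm x y′)))
        (Γ-down x′∈Γ (x⊕y≼y x x′) p) (Γ-down y′∈Γ (x⊕y≼y y y′) q)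
    ... | inj₂ c | inj₂ c′ with x∈Γ , y∈Γ , _ ← Closure⇒B₀ c =
      ≈-or-Closure (ruleⁱⁱ c c′ ≈-refl ≈-refl)
        (Γ-down x∈Γ (x⊕y≼x x x′) p) (Γ-down y∈Γ (x⊕y≼x y y′) q)

    -- The guard passes from `apply a g` to `g`; above γ, being ∞ in the quotient means lying in Γ,
    -- so the base rule applies.
    Linked-apply : ∀ a {g h} → Reachability._≈Γ_ F Γ g h →
                   (g ∈ Γ → h ∈ Γ → ¬ g ≈ᴴ h → R g h) → Linked R (apply a g) (apply a h)
    Linked-apply a (inj₁ g≈h) _ _ _ = inj₁ (·-cong Ver.refl g≈h)
    Linked-apply a {g} {h} (inj₂ (g⊁Γ , h⊁Γ)) f p q
      with g ≈? h
         | ¬≻⇒∈Γ (≼-trans Γ p (⟦ letter a ⟧ᵥ , ≈-refl)) g⊁Γ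
         | ¬≻⇒∈Γ (≼-trans Γ q (⟦ letter a ⟧ᵥ , ≈-refl)) h⊁Γ
    ... | yes g≈h | _   | _   = inj₁ (·-cong Ver.refl g≈h)
    ... | no  g≉h | g∈Γ | h∈Γ =
      ≈-or-Closure (base a (f g∈Γ h∈Γ g≉h) ≈-refl ≈-refl)
        (Γ-down g∈Γ (_ , ≈-refl) p) (Γ-down h∈Γ (_ , ≈-refl) q)

  -- Matching root trees

  module Matching (k : ℕ) where
    rootSetoid : Setoid 0ℓ 0ℓ
    rootSetoid = labels (αΓ α Γ) ×ₛ Sim-setoid k

    open Membership rootSetoid using () renaming (_∈_ to _∈ᵣ_)

    rootsOf : Forest A → _
    rootsOf s = roots (relabel (αΓ α Γ) s)

    rootOf : A → Forest A → Setoid.Carrier rootSetoid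
    rootOf a u = (a , value u) , relabel (αΓ α Γ) u

    -- Some tree of `t` realises the root; adding a second copy of it changes nothing by
    -- idempotence.
    absorb-root : ∀ {r} t → r ∈ᵣ rootsOf t →
      ∃₂ λ a u → Setoid._≈_ rootSetoid r (rootOf a u) × apply a (value u) ⊕ value t ≈ᴴ value t
    absorb-root (node a u ∷ t) (here p) = a , u , p , (begin
      apply a (value u) ⊕ value (node a u ∷ t)             ≈⟨ ∙-congˡ (value-∷ a u t) ⟩
      apply a (value u) ⊕ (apply a (value u) ⊕ value t)    ≈⟨ assoc _ _ _ ⟨
      apply a (value u) ⊕ apply a (value u) ⊕ value t      ≈⟨ ∙-congʳ (+-idem _) ⟩
      apply a (value u) ⊕ value t                          ≈⟨ value-∷ a u t ⟨
      value (node a u ∷ t)                                 ∎)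
      where open SetoidReasoning Hor.setoid
    absorb-root (node b w ∷ t) (there r∈t) with a , u , p , e ← absorb-root t r∈t =
      a , u , p , (begin
      apply a (value u) ⊕ value (node b w ∷ t)             ≈⟨ ∙-congˡ (value-∷ b w t) ⟩
      apply a (value u) ⊕ (apply b (value w) ⊕ value t)    ≈⟨ x∙yz≈y∙xz _ _ _ ⟩
      apply b (value w) ⊕ (apply a (value u) ⊕ value t)    ≈⟨ ∙-congˡ e ⟩
      apply b (value w) ⊕ value t                          ≈⟨ value-∷ b w t ⟨
      value (node b w ∷ t)                                 ∎)
      where open SetoidReasoning Hor.setoid

    -- m is the sum of the trees of t chosen to match the trees of s; idempotence
    -- lets value t absorb it.
    match : (_∼_ : Rel |H| 0ℓ) →
      (∀ {x y x′ y′} → x ∼ y → x′ ∼ y′ → (x ⊕ x′) ∼ (y ⊕ y′)) →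
      0# ∼ 0# →
      (∀ {a u b w} → Setoid._≈_ rootSetoid (rootOf a u) (rootOf b w) →
        apply a (value u) ∼ apply b (value w)) →
      ∀ s t → (∀ {r} → r ∈ᵣ rootsOf s → r ∈ᵣ rootsOf t) →
      ∃₂ λ n m → n ≈ᴴ value s × n ∼ m × m ⊕ value t ≈ᴴ value t
    match _∼_ ∼-⊕ ∼-0 ∼-root []             t s⊆t =
      0# , 0# , ≈-sym ε-homo , ∼-0 , identityˡ _
    match _∼_ ∼-⊕ ∼-0 ∼-root (node a u ∷ s) t s⊆t
      with b , w , p , e ← absorb-root t (s⊆t (here (Setoid.refl rootSetoid {rootOf a u})))
         | n , m , n≈s , n∼m , e′ ← match _∼_ ∼-⊕ ∼-0 ∼-root s t (λ r∈s → s⊆t (there r∈s)) =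
        apply a (value u) ⊕ n , apply b (value w) ⊕ m
      , ≈-trans (∙-congˡ n≈s) (≈-sym (value-∷ a u s))
      , ∼-⊕ (∼-root {a} {u} {b} {w} p) n∼m
      , ≈-trans (assoc _ _ _) (≈-trans (∙-congˡ e′) e)

  -- From forests to derivations

  Confused⇒B : ∀ k {h h′} → B₀ h h′ → Confused k h h′ → B α Γ k h h′
  Confused⇒B zero    b₀ _ = b₀
  Confused⇒B (suc k) {h} {h′} b₀@(h∈Γ , h′∈Γ , h≉h′) (s , t , (s⊆t , t⊆s) , s≈h , t≈h′) =
    let n , m , n≈s , n∼m , m⊕t≈t = match _∼_ (λ p q → Linked-⊕ p q) Linked-0 ∼-root s t s⊆t
        n′ , m′ , n′≈t , m′∼n′ , m′⊕s≈s =
          -- Flipping keeps every pair oriented from `s` to `t` although the trees of `t` are now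
          -- the ones being matched.
          match (flip _∼_) (λ p q → Linked-⊕ p q) Linked-0
            (λ {a} {u} {b} {w} p → ∼-root {b} {w} {a} {u}
              (Setoid.sym rootSetoid {rootOf a u} {rootOf b w} p)) t s t⊆s
    in
    -- The left sum is `m′ ⊕ n`, where `value s` absorbs `m′`; the right one is `n′ ⊕ m`, where
    -- `value t` absorbs `m`. They equal `h` and `h′`.
    conclude (Linked-⊕ m′∼n′ n∼m)
      (≈-trans (∙-congˡ n≈s) (≈-trans m′⊕s≈s s≈h))
      (≈-trans (∙-congʳ n′≈t) (≈-trans (+-comm _ _) (≈-trans m⊕t≈t t≈h′)))
    where
    open Matching k

    _∼_ : Rel |H| 0ℓ
    _∼_ = Linked (B α Γ k)

    ∼-root : ∀ {a u b w} → Setoid._≈_ rootSetoid (rootOf a u) (rootOf b w) →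
             apply a (value u) ∼ apply b (value w)
    ∼-root {a} {u} {_} {w} ((refl , u≈w) , u∼w) = Linked-apply a u≈w λ u∈Γ w∈Γ u≉w →
      -- The child forests themselves witness confusion one level down.
      Confused⇒B k (u∈Γ , w∈Γ , u≉w) (u , w , u∼w , ≈-refl , ≈-refl)

    conclude : ∀ {x y} → x ∼ y → x ≈ᴴ h → y ≈ᴴ h′ → Closure (B α Γ k) h h′
    conclude x∼y x≈h y≈h′
      with x∼y (≼-trans Γ (∈Γ⇒γ≼ h∈Γ) (≈⇒≼ Γ (≈-sym x≈h)))
               (≼-trans Γ (∈Γ⇒γ≼ h′∈Γ) (≈⇒≼ Γ (≈-sym y≈h′)))
    ... | inj₁ x≈y = contradiction (≈-trans (≈-sym x≈h) (≈-trans x≈y y≈h′)) h≉h′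
    ... | inj₂ c   = Closure-resp (≈-sym x≈h) (≈-sym y≈h′) b₀ c

theorem4 : (A : Set) → Finite (setoid A) →
    (F : ForestAlgebra) → IsFinite F →
    Idempotent (_≈_ F) (_+_ F) → Commutative (_≈_ F) (_+_ F) →
    (α : Homomorphism (A ^Δ) F) → IsOnto α →
    (Γ : Pred (H F) 0ℓ) → IsReachabilityClass F Γ →
    (∀ (h h′ : H F) → h ∈ Γ → h′ ∈ Γ → ¬ (_≈_ F h h′) → ∀ (k : ℕ) →
    B α Γ k h h′ ⇔
    (∃₂ λ (s t : Forest A) →
    (labels (αΓ α Γ) ⊢ relabel (αΓ α Γ) s ∼[ k ] relabel (αΓ α Γ) t)
    × _≈_ F (⟦ α ⟧ₕ s) h × _≈_ F (⟦ α ⟧ₕ t) h′))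
    × (∀ (k : ℕ) (h h′ : H F) → B α Γ (suc k) h h′ → B α Γ k h h′)
theorem4 A _ F F-finite idem comm α onto Γ isClass =
    (λ h h′ h∈Γ h′∈Γ h≉h′ k → mk⇔ (B⇒Confused k) (Confused⇒B k (h∈Γ , h′∈Γ , h≉h′)))
  , (λ k h h′ → B-antitone k)
  where open Proof F F-finite idem comm α onto Γ isClass
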